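{- Let $D=(G,F)$ be a data flow framework over $\mathcal{T}$ with $V(G)=\{1,\dots,n\}$ and let $f_D:\overline{\mathcal{G}(\mathcal{T})}^n\to\overline{\mathcal{G}(\mathcal{T})}^n$ be its composite transfer function. Then: 1. $f_D$ is monotone, distributive and continuous. 2. The component maps $f_k=\pi_k\circ f_D$ are continuous for all $k\in\{1,2,\dots,n\}$. 3. $f_D$ has a maximum fix-point. 4. If $S=\{\top_n,f_D(\top_n),f_D^2(\top_n),\dots\}$, then $\bigwedge_n S$ is the maximum fix-point of $f_D$.
   Context: Terms. $C$ is a countable set of constants, $X$ a countable set of variables, and $\mathcal{T}$ is the set of formal expressions given by $t::=c\mid x\mid (t+t)$ with $c\in C$, $x\in X$. $t[x\leftarrow\alpha]$ denotes the term obtained from $t$ by replacing every occurrence of the variable $x$ by the term $\alpha$. $\mathcal{T}(y)$ is the set of terms in which $y$ appears, and $\overline{\mathcal{T}}(y)=\mathcal{T}\setminus\mathcal{T}(y)$. Congruences. For a partition $\mathcal{P}$ of $\mathcal{T}$ write $t\cong_{\mathcal{P}}t'$ if $t,t'$ lie in the same class. $\mathcal{P}$ is a congruence if: (1) distinct constants $c\neq c'$ satisfy $c\ncong_{\mathcal P} c'$; (2) for all $t,t',s,s'\in\mathcal{T}$, ($t'\cong_{\mathcal P} t$ and $s'\cong_{\mathcal P} s$) if and only if $t'+s'\cong_{\mathcal P} t+s$; (3) for $c\in C$, $t\in\mathcal{T}$, if $t\cong_{\mathcal P} c$ then $t=c$ or $t\in X$. $\mathcal{G}(\mathcal{T})$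 is the set of all congruences, ordered by refinement: $\mathcal{P}\preceq\mathcal{P}'$ if each class of $\mathcal{P}$ is contained in a class of $\mathcal{P}'$. $\bot=\{\{t\}:t\in\mathcal{T}\}$. $\overline{\mathcal{G}(\mathcal{T})}=\mathcal{G}(\mathcal{T})\cup\{\top\}$ where $\top$ is an added element with $\mathcal{P}\preceq\top$ for all $\mathcal{P}$; it is a complete lattice. $\wedge,\bigwedge$ denote greatest lower bounds in it; in particular $\bigwedge\emptyset=\top$. Transfer functions. For $y\in X$, $\beta\in\overline{\mathcal{T}}(y)$ and $\mathcal{P}\in\mathcal{G}(\mathcal{T})$, $f_{y=\beta}(\mathcal{P})$ is the congruence with $t\cong_{f_{y=\beta}(\mathcal{P})}t'$ iff $t[y\leftarrow\beta]\cong_{\mathcal{P}}t'[y\leftarrow\beta]$. The non-deterministic assignment $f_{y=*}(\mathcal{P})$ is the congruence with $t\cong_{f_{y=*}(\mathcal{P})}t'$ iff $t\cong_{\mathcal{P}}t'$ and $t[y\leftarrow\beta]\cong_{\mathcal{P}}t'[y\leftarrow\beta]$ for every $\beta\in\overline{\mathcal{T}}(y)$. Both kinds are called transfer functions, and are extended to $\overline{\mathcal{G}(\mathcal{T})}$ by $\top\mapsto\top$. Data flow frameworks. A control flow graph $G(V,E)$ is a directed graph on $V=\{1,\dots,n\}$, $n\ge1$, such that the entry point $1$ has no predecessors, and every vertex $i\neq1$ is reachable from $1$ and has one or two predecessors. Vertices with two predecessors are confluence points; vertices with exactly one predecessor are function points. $\mathrm{Pred}(k)$ is the set of predecessors of $k$.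 A data flow framework over $\mathcal{T}$ is $D=(G,F)$ with $G$ a control flow graph and $F=\{h_i: i \text{ a function point}\}$, where $h_i$ is a transfer function (used in its extended form $\overline{\mathcal{G}(\mathcal{T})}\to\overline{\mathcal{G}(\mathcal{T})}$) associated with the function point $i$. Composite transfer function. On $\overline{\mathcal{G}(\mathcal{T})}^n$ use the componentwise order $\preceq_n$, with top element $\top_n=(\top,\dots,\top)$, greatest lower bounds denoted $\bigwedge_n$, and coordinate projections $\pi_i$. The composite transfer function $f_D$ is the unique function whose components $\pi_k\circ f_D=f_k$ are: $f_1$ is constantly $\bot$; $f_k=h_k\circ\pi_j$ if $k$ is a function point with $\mathrm{Pred}(k)=\{j\}$; $f_k(\mathcal{P}_1,\dots,\mathcal{P}_n)=\mathcal{P}_i\wedge\mathcal{P}_j$ if $k$ is a confluence point with $\mathrm{Pred}(k)=\{i,j\}$. A map $f:L\to L'$ of complete lattices is continuous if $f(\bigwedge S)=\bigwedge f(S)$ for every non-empty $S\subseteq L$ (arbitrary non-empty subsets, not only chains), distributive if $f(s\wedge s')=f(s)\wedge f(s')$, monotone if $s\le s'$ implies $f(s)\le f(s')$. A maximum fix-point of $f:L\to L$ is a fix-point $s$ such that $s'\le s$ for every fix-point $s'$. -}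

module Defs where

open import Level using (Level; 0ℓ; _⊔_) renaming (suc to lsuc)
open import Data.Fin.Base using (Fin; zero; suc)
open import Data.Nat.Base using (ℕ; suc)
open import Data.Nat.GeneralisedArithmetic using (fold)
import Data.Nat.Properties as ℕ
open import Data.Product.Base using (∃; ∃₂; _×_; _,_; proj₁; proj₂)
open import Data.Sum.Base using (_⊎_; inj₁; inj₂)
open import Data.Vec.Functional using (Vector; replicate; zipWith)
open import Data.Vec.Functional.Relation.Binary.Pointwise using (Pointwise)
import Data.Vec.Functional.Relation.Binary.Pointwise.Properties as Pointwiseₚ
open import Function.Base using (_∘_)
open import Function.Bundles using (_↣_; _⇔_; mk⇔; Equivalence)
open import Relation.Binary.Bundles using (Poset)
open import Relation.Binary.Core using (Rel; _Preserves_⟶_)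
open import Relation.Binary.Definitions using (DecidableEquality)
open import Relation.Binary.Structures using (IsEquivalence; IsPartialOrder)
open import Relation.Binary.Construct.Closure.ReflexiveTransitive using (Star)
import Relation.Binary.Construct.Add.Supremum.Equality as AddEquality
import Relation.Binary.Construct.Add.Supremum.NonStrict as AddNonStrict
open import Relation.Binary.Lattice.Bundles
  using (MeetSemilattice; BoundedMeetSemilattice)
open import Relation.Binary.Lattice.Definitions using (Infimum)
open import Relation.Binary.PropositionalEquality.Core
  using (_≡_; _≢_; refl; cong₂)
import Relation.Binary.PropositionalEquality.Properties as ≡ₚ
open import Relation.Nullary.Construct.Add.Supremum using (_⁺; ⊤⁺; [_])
open import Relation.Nullary.Decidable.Core using (yes; no)
open import Relation.Nullary.Decidable using (via-injection)
open import Relation.Nullary.Negation.Core using (¬_)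
open import Relation.Unary using (Pred; _∈_; _⊆_; _≐_; _∪_; ｛_｝; ∁; Satisfiable)

-- Finite or countably infinite.
Countable : Set → Set
Countable A = A ↣ ℕ

------------------------------------------------------------------------
-- Order theory

module _ {c ℓ₁ ℓ₂} (P : Poset c ℓ₁ ℓ₂) where
  open Poset P

  record IsGreatestLowerBound {ℓ} (S : Pred Carrier ℓ) (g : Carrier)
         : Set (c ⊔ ℓ₂ ⊔ ℓ) where
    field
      isLowerBound : ∀ {s} → s ∈ S → g ≤ s
      isGreatest   : ∀ {x} → (∀ {s} → s ∈ S → x ≤ s) → x ≤ g

  IsFixpoint : (Carrier → Carrier) → Pred Carrier ℓ₁
  IsFixpoint f s = f s ≈ s

  IsMaximumFixpoint : (Carrier → Carrier) → Pred Carrier (c ⊔ ℓ₁ ⊔ ℓ₂)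
  IsMaximumFixpoint f s = IsFixpoint f s × (∀ s′ → IsFixpoint f s′ → s′ ≤ s)

  Iterates : (Carrier → Carrier) → Carrier → Pred Carrier ℓ₁
  Iterates f x y = ∃ λ m → y ≈ fold x f m

module _ {c ℓ₁ ℓ₂ c′ ℓ₁′ ℓ₂′}
         (P : Poset c ℓ₁ ℓ₂) (Q : Poset c′ ℓ₁′ ℓ₂′) where
  private
    module P = Poset P
    module Q = Poset Q

  Monotone : (P.Carrier → Q.Carrier) → Set (c ⊔ ℓ₂ ⊔ ℓ₂′)
  Monotone f = f Preserves P._≤_ ⟶ Q._≤_

  Image : ∀ {ℓ} → (P.Carrier → Q.Carrier) → Pred P.Carrier ℓ →
          Pred Q.Carrier (c ⊔ ℓ₁′ ⊔ ℓ)
  Image f S y = ∃ λ x → x ∈ S × y Q.≈ f x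

  -- f(⋀S) = ⋀f(S) for non-empty S, where "g = ⋀S" is the relation
  -- IsGreatestLowerBound S g: constructively there is no operation ⋀
  -- on arbitrary subsets.  The level ℓ of the subsets is arbitrary.
  Continuous : (ℓ : Level) → (P.Carrier → Q.Carrier) →
               Set (c ⊔ ℓ₂ ⊔ c′ ⊔ ℓ₁′ ⊔ ℓ₂′ ⊔ lsuc ℓ)
  Continuous ℓ f = (S : Pred P.Carrier ℓ) → Satisfiable S → ∀ {g} →
    IsGreatestLowerBound P S g → IsGreatestLowerBound Q (Image f S) (f g)

module _ {c ℓ₁ ℓ₂ c′ ℓ₁′ ℓ₂′}
         (L : MeetSemilattice c ℓ₁ ℓ₂) (L′ : MeetSemilattice c′ ℓ₁′ ℓ₂′) where
  private
    module L = MeetSemilattice L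
    module L′ = MeetSemilattice L′

  Distributive : (L.Carrier → L′.Carrier) → Set (c ⊔ ℓ₁′)
  Distributive f = ∀ s s′ → f (s L.∧ s′) L′.≈ (f s L′.∧ f s′)

power : ∀ {c ℓ₁ ℓ₂} → BoundedMeetSemilattice c ℓ₁ ℓ₂ → ℕ →
        BoundedMeetSemilattice c ℓ₁ ℓ₂
power L n = record
  { Carrier = Vector L.Carrier n
  ; _≈_     = Pointwise L._≈_
  ; _≤_     = Pointwise L._≤_
  ; _∧_     = zipWith L._∧_
  ; ⊤       = replicate n L.⊤
  ; isBoundedMeetSemilattice = record
    { isMeetSemilattice = record
      { isPartialOrder = record
        { isPreorder = record
          { isEquivalence = Pointwiseₚ.isEquivalence L.isEquivalence n
          ; reflexive     = λ p i → L.reflexive (p i)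
          ; trans         = λ p q i → L.trans (p i) (q i)
          }
        ; antisym = λ p q i → L.antisym (p i) (q i)
        }
      ; infimum = λ xs ys →
            (λ i → L.x∧y≤x (xs i) (ys i))
          , (λ i → L.x∧y≤y (xs i) (ys i))
          , λ zs p q i → L.∧-greatest (p i) (q i)
      }
    ; maximum = λ xs i → L.maximum (xs i)
    }
  }
  where module L = BoundedMeetSemilattice L

------------------------------------------------------------------------
-- Control flow graphs

-- The vertices 1, …, n are Fin (suc m) with n = suc m; the entry
-- point 1 is zero.
module _ {m : ℕ} (_⟶_ : Rel (Fin (suc m)) 0ℓ) where

  Predecessors : Fin (suc m) → Pred (Fin (suc m)) 0ℓ
  Predecessors k i = i ⟶ k

  FunctionPoint : Pred (Fin (suc m)) 0ℓ
  FunctionPoint k = ∃ λ j → Predecessors k ≐ ｛ j ｝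

  ConfluencePoint : Pred (Fin (suc m)) 0ℓ
  ConfluencePoint k = ∃₂ λ i j → i ≢ j × Predecessors k ≐ ｛ i ｝ ∪ ｛ j ｝

suc≢zero : ∀ {n} {i : Fin n} → suc i ≢ zero
suc≢zero ()

record ControlFlowGraph (m : ℕ) : Set₁ where
  infix 4 _⟶_
  field
    _⟶_          : Rel (Fin (suc m)) 0ℓ
    entry-source : ∀ i → ¬ (i ⟶ zero)
    reachable    : ∀ k → k ≢ zero → Star _⟶_ zero k
    one-or-two   : ∀ k → k ≢ zero →
                   FunctionPoint _⟶_ k ⊎ ConfluencePoint _⟶_ k

------------------------------------------------------------------------
-- Terms, congruences and data flow frameworks

module Framework (C X : Set) (X-countable : Countable X) where

  infixl 6 _+_

  data Term : Set where
    con : C → Term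
    var : X → Term
    _+_ : Term → Term → Term

  infix 4 _≟_
  _≟_ : DecidableEquality X
  _≟_ = via-injection X-countable ℕ._≟_

  infix 8 _[_←_]
  _[_←_] : Term → X → Term → Term
  con c    [ y ← β ] = con c
  var x    [ y ← β ] with x ≟ y
  ... | yes _ = β
  ... | no  _ = var x
  (t + t′) [ y ← β ] = t [ y ← β ] + t′ [ y ← β ]

  data 𝒯 (y : X) : Pred Term 0ℓ where
    here  : var y ∈ 𝒯 y
    left  : ∀ {t t′} → t  ∈ 𝒯 y → (t + t′) ∈ 𝒯 y
    right : ∀ {t t′} → t′ ∈ 𝒯 y → (t + t′) ∈ 𝒯 y

  𝒯̄ : X → Pred Term 0ℓ
  𝒯̄ y = ∁ (𝒯 y)

  -- A partition of the terms is given by its equivalence relation "lie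
  -- in the same class".
  record Congruence : Set₁ where
    infix 4 _≅_
    field
      _≅_           : Rel Term 0ℓ
      isEquivalence : IsEquivalence _≅_
      con-distinct  : ∀ {c c′} → c ≢ c′ → ¬ (con c ≅ con c′)
      +-cong-⇔      : ∀ {t t′ s s′} →
                      (t′ ≅ t × s′ ≅ s) ⇔ (t′ + s′ ≅ t + s)
      con-class     : ∀ {c t} → t ≅ con c → t ≡ con c ⊎ ∃ λ x → t ≡ var x

    open IsEquivalence isEquivalence public

  infix 4 _∋_≅_
  _∋_≅_ : Congruence → Rel Term 0ℓ
  P ∋ t ≅ t′ = Congruence._≅_ P t t′

  class : Congruence → Term → Pred Term 0ℓ
  class P t s = P ∋ s ≅ t

  -- P ≈ᶜ Q is equality of partitions.
  infix 4 _⪯_ _≈ᶜ_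
  _⪯_ : Rel Congruence 0ℓ
  P ⪯ Q = ∀ t → ∃ λ t′ → class P t ⊆ class Q t′

  _≈ᶜ_ : Rel Congruence 0ℓ
  P ≈ᶜ Q = ∀ t → class P t ≐ class Q t

  ⪯⇒⊆ : ∀ {P Q} → P ⪯ Q → ∀ t → class P t ⊆ class Q t
  ⪯⇒⊆ {P} {Q} P⪯Q t s≅t =
    let _ , f = P⪯Q t in Q.trans (f s≅t) (Q.sym (f P.refl))
    where
    module P = Congruence P
    module Q = Congruence Q

  ⪯-isPartialOrder : IsPartialOrder _≈ᶜ_ _⪯_
  ⪯-isPartialOrder = record
    { isPreorder = record
      { isEquivalence = record
        { refl  = λ t → (λ p → p) , (λ p → p)
        ; sym   = λ e t → proj₂ (e t) , proj₁ (e t)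
        ; trans = λ e f t → proj₁ (f t) ∘ proj₁ (e t)
                          , proj₂ (e t) ∘ proj₂ (f t)
        }
      ; reflexive = λ e t → t , proj₁ (e t)
      ; trans     = λ p q t →
          let t′ , f = p t ; t″ , g = q t′ in t″ , g ∘ f
      }
    ; antisym = λ {P} {Q} p q t → ⪯⇒⊆ {P} {Q} p t , ⪯⇒⊆ {Q} {P} q t
    }

  ⊥ᶜ : Congruence
  ⊥ᶜ = record
    { _≅_           = _≡_
    ; isEquivalence = ≡ₚ.isEquivalence
    ; con-distinct  = λ { c≢c′ refl → c≢c′ refl }
    ; +-cong-⇔      = mk⇔ (λ (p , q) → cong₂ _+_ p q) λ { refl → refl , refl }
    ; con-class     = inj₁
    }

  infixr 7 _∧ᶜ_
  _∧ᶜ_ : Congruence → Congruence → Congruence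
  P ∧ᶜ Q = record
    { _≅_           = λ t t′ → P ∋ t ≅ t′ × Q ∋ t ≅ t′
    ; isEquivalence = record
      { refl  = P.refl , Q.refl
      ; sym   = λ (p , q) → P.sym p , Q.sym q
      ; trans = λ (p , q) (p′ , q′) → P.trans p p′ , Q.trans q q′
      }
    ; con-distinct  = λ c≢c′ (p , _) → P.con-distinct c≢c′ p
    ; +-cong-⇔      = mk⇔
        (λ ((p , q) , (p′ , q′)) → Equivalence.to P.+-cong-⇔ (p , p′)
                                 , Equivalence.to Q.+-cong-⇔ (q , q′))
        (λ (p , q) →
          let p₁ , p₂ = Equivalence.from P.+-cong-⇔ p
              q₁ , q₂ = Equivalence.from Q.+-cong-⇔ q
          in (p₁ , q₁) , (p₂ , q₂))
    ; con-class     = λ (p , _) → P.con-class p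
    }
    where
    module P = Congruence P
    module Q = Congruence Q

  infixr 7 _∧⁺_
  _∧⁺_ : Congruence ⁺ → Congruence ⁺ → Congruence ⁺
  [ P ] ∧⁺ [ Q ] = [ P ∧ᶜ Q ]
  [ P ] ∧⁺ ⊤⁺    = [ P ]
  ⊤⁺    ∧⁺ Q     = Q

  open AddEquality _≈ᶜ_ using (_≈⁺_)
  open AddNonStrict _⪯_ using (_≤⁺_; [_]; _≤⊤⁺; ≤⁺-isPartialOrder)
  private module ⁺ = IsPartialOrder (≤⁺-isPartialOrder ⪯-isPartialOrder)

  ∧⁺-infimum : Infimum _≤⁺_ _∧⁺_
  ∧⁺-infimum [ P ] [ Q ] =
      [ (λ t → t , proj₁) ]
    , [ (λ t → t , proj₂) ]
    , λ { [ R ] [ p ] [ q ] →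
          [ (λ t → t , λ r → ⪯⇒⊆ {R} {P} p t r , ⪯⇒⊆ {R} {Q} q t r) ] }
  ∧⁺-infimum [ P ] ⊤⁺ = ⁺.refl , ([ P ] ≤⊤⁺) , λ _ p _ → p
  ∧⁺-infimum ⊤⁺    Q  = (Q ≤⊤⁺) , ⁺.refl , λ _ _ q → q

  -- The congruences with an added top element.
  𝒢̄ : BoundedMeetSemilattice (lsuc 0ℓ) (lsuc 0ℓ) (lsuc 0ℓ)
  𝒢̄ = record
    { Carrier = Congruence ⁺
    ; _≈_     = _≈⁺_
    ; _≤_     = _≤⁺_
    ; _∧_     = _∧⁺_
    ; ⊤       = ⊤⁺
    ; isBoundedMeetSemilattice = record
      { isMeetSemilattice = record
        { isPartialOrder = ≤⁺-isPartialOrder ⪯-isPartialOrder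
        ; infimum        = ∧⁺-infimum
        }
      ; maximum = _≤⊤⁺
      }
    }

  𝒢̄^_ : ℕ → BoundedMeetSemilattice (lsuc 0ℓ) (lsuc 0ℓ) (lsuc 0ℓ)
  𝒢̄^ n = power 𝒢̄ n

  assign : X → Term → Congruence → Congruence
  assign y β P = record
    { _≅_           = λ t t′ → P ∋ t [ y ← β ] ≅ t′ [ y ← β ]
    ; isEquivalence = record { refl = P.refl ; sym = P.sym ; trans = P.trans }
    ; con-distinct  = P.con-distinct
    ; +-cong-⇔      = P.+-cong-⇔
    ; con-class     = λ {c} {t} → class-of c t
    }
    where
    module P = Congruence P
    class-of : ∀ c t → P ∋ t [ y ← β ] ≅ con c → t ≡ con c ⊎ ∃ λ x → t ≡ var x
    class-of c (con c′) p = P.con-class p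
    class-of c (var x)  p = inj₂ (x , refl)
    class-of c (t + t′) p with P.con-class p
    ... | inj₁ ()
    ... | inj₂ (_ , ())

  forget : X → Congruence → Congruence
  forget y P = record
    { _≅_           = λ t t′ → P ∋ t ≅ t′ ×
                        (∀ β → β ∈ 𝒯̄ y → P ∋ t [ y ← β ] ≅ t′ [ y ← β ])
    ; isEquivalence = record
      { refl  = P.refl , λ _ _ → P.refl
      ; sym   = λ (p , q) → P.sym p , λ β β∉ → P.sym (q β β∉)
      ; trans = λ (p , q) (p′ , q′) →
          P.trans p p′ , λ β β∉ → P.trans (q β β∉) (q′ β β∉)
      }
    ; con-distinct  = λ c≢c′ (p , _) → P.con-distinct c≢c′ p
    ; +-cong-⇔      = mk⇔
        (λ ((p , q) , (p′ , q′)) → Equivalence.to P.+-cong-⇔ (p , p′)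
          , λ β β∉ → Equivalence.to P.+-cong-⇔ (q β β∉ , q′ β β∉))
        (λ (p , q) →
          let p₁ , p₂ = Equivalence.from P.+-cong-⇔ p
          in (p₁ , λ β β∉ → proj₁ (Equivalence.from P.+-cong-⇔ (q β β∉)))
           , (p₂ , λ β β∉ → proj₂ (Equivalence.from P.+-cong-⇔ (q β β∉))))
    ; con-class     = λ (p , _) → P.con-class p
    }
    where module P = Congruence P

  data TransferFunction : Set where
    _≔_∣_ : (y : X) (β : Term) → β ∈ 𝒯̄ y → TransferFunction
    _≔*   : X → TransferFunction

  ⟦_⟧ : TransferFunction → Congruence → Congruence
  ⟦ y ≔ β ∣ _ ⟧ = assign y β
  ⟦ y ≔* ⟧      = forget y

  ⟦_⟧⁺ : TransferFunction → Congruence ⁺ → Congruence ⁺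
  ⟦ h ⟧⁺ [ P ] = [ ⟦ h ⟧ P ]
  ⟦ h ⟧⁺ ⊤⁺    = ⊤⁺

  -- The proof in h is irrelevant, so that h depends on the vertex only.
  record DataFlowFramework (m : ℕ) : Set₁ where
    field
      graph : ControlFlowGraph m
    open ControlFlowGraph graph public
    field
      h : ∀ k → .(FunctionPoint _⟶_ k) → TransferFunction

    component : Fin (suc m) → Vector (Congruence ⁺) (suc m) → Congruence ⁺
    component zero      Ps = [ ⊥ᶜ ]
    component k@(suc _) Ps with one-or-two k suc≢zero
    ... | inj₁ p@(j , _)   = ⟦ h k p ⟧⁺ (Ps j)
    ... | inj₂ (i , j , _) = Ps i ∧⁺ Ps j

    composite : Vector (Congruence ⁺) (suc m) → Vector (Congruence ⁺) (suc m)
    composite Ps k = component k Ps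

{-# OPTIONS --safe #-}

-- The meet of a non-empty set S of congruences is their intersection, and both
-- kinds of transfer function are defined by conditions t[y ← β] ≅ t′[y ← β] on
-- their argument, so they commute with meets.  Constructively the intersection
-- of a large S is not available as a congruence; instead a pair identified by
-- all members of S is identified by ⋀S because the congruence generated by that
-- single pair is a lower bound of S.
-- The maximum fixed point is Kleene's.  The meet of the iterates exists since
-- every vertex is reachable from the entry point, so that each coordinate of the
-- iterates eventually leaves ⊤ and the coordinatewise intersection is again a
-- congruence.
module Submission where

open import Defs
open import Level using (Level; 0ℓ; _⊔_) renaming (suc to lsuc)
open import Data.Empty using (⊥-elim)
open import Data.Fin.Base using (Fin; zero; suc)
import Data.Fin.Properties as Fin
open import Data.Nat.Base using (ℕ; zero; suc)
open import Data.Nat.GeneralisedArithmetic using (fold)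
import Data.Nat.Properties as ℕ
open import Data.Product.Base using (∃; _×_; _,_; proj₁; proj₂)
open import Data.Sum.Base using (_⊎_; inj₁; inj₂)
open import Data.Unit.Base using (tt) renaming (⊤ to Unit)
open import Data.Vec.Functional using (Vector; updateAt)
open import Data.Vec.Functional.Properties using (updateAt-updates; updateAt-minimal)
open import Function.Base using (_∘_; const)
open import Function.Bundles using (_⇔_; mk⇔; Equivalence)
open import Relation.Binary.Bundles using (Poset)
open import Relation.Binary.Construct.Closure.ReflexiveTransitive using (Star; ε; _◅_)
import Relation.Binary.Construct.Add.Supremum.NonStrict as AddNonStrict
open import Relation.Binary.Core using (Rel)
open import Relation.Binary.Definitions using (DecidableEquality)
open import Relation.Binary.Lattice.Bundles using (MeetSemilattice; BoundedMeetSemilattice)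
open import Relation.Binary.PropositionalEquality.Core using (_≡_; refl; sym; subst)
open import Relation.Binary.Structures using (IsEquivalence)
open import Relation.Nullary.Construct.Add.Supremum using (_⁺; ⊤⁺; [_])
open import Relation.Nullary.Decidable using (via-injection)
open import Relation.Nullary.Decidable.Core using (yes; no)
open import Relation.Nullary.Negation.Core using (¬_)
open import Relation.Unary using (Pred; _∈_; _∪_; ｛_｝)
open BoundedMeetSemilattice using (poset; meetSemilattice; ⊤)

-- Continuous maps

module _ {c ℓ₁ ℓ₂ c′ ℓ₁′ ℓ₂′} (P : Poset c ℓ₁ ℓ₂) (Q : Poset c′ ℓ₁′ ℓ₂′) where
  private
    module P = Poset P
    module Q = Poset Q

  -- If `x ≤ y`, then `x` is the meet of the pair `x`, `y`, so `f x` is a lower bound of an image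
  -- that contains `f y`. The pair is formed with `≡`, hence the level `c`.
  continuous⇒monotone : ∀ {f} → Continuous P Q c f → Monotone P Q f
  continuous⇒monotone f-cont {x} {y} x≤y =
    isLowerBound (f-cont (｛ x ｝ ∪ ｛ y ｝) (x , inj₁ refl) x-glb)
      (y , inj₂ refl , Q.Eq.refl)
    where
    open IsGreatestLowerBound
    x-glb : IsGreatestLowerBound P (｛ x ｝ ∪ ｛ y ｝) x
    x-glb = record
      { isLowerBound = λ { (inj₁ refl) → P.refl ; (inj₂ refl) → x≤y }
      ; isGreatest   = λ lb → lb (inj₁ refl)
      }

  monotone⇒cong : ∀ {f} → Monotone P Q f → ∀ {x y} → x P.≈ y → f x Q.≈ f y
  monotone⇒cong f-mono x≈y =
    Q.antisym (f-mono (P.reflexive x≈y)) (f-mono (P.reflexive (P.Eq.sym x≈y)))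

  const-continuous : ∀ {ℓ} q → Continuous P Q ℓ (const q)
  const-continuous q S (x , x∈S) glb = record
    { isLowerBound = λ (_ , _ , y≈q) → Q.reflexive (Q.Eq.sym y≈q)
    ; isGreatest   = λ lb → lb (x , x∈S , Q.Eq.refl)
    }

module _ {c ℓ₁ ℓ₂ c′ ℓ₁′ ℓ₂′ c″ ℓ₁″ ℓ₂″}
         (P : Poset c ℓ₁ ℓ₂) (Q : Poset c′ ℓ₁′ ℓ₂′) (R : Poset c″ ℓ₁″ ℓ₂″) where
  private
    module Q = Poset Q
    module R = Poset R

  -- The image of an image also contains `g y` for `y` merely equivalent to `f x`. Monotonicity of
  -- `g` is what makes such a `g y` equivalent to `g (f x)`.
  ∘-continuous : ∀ {ℓ f g} → Monotone Q R g → Continuous Q R (c ⊔ ℓ₁′ ⊔ ℓ) g →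
                 Continuous P Q ℓ f → Continuous P R ℓ (g ∘ f)
  ∘-continuous {f = f} {g} g-mono g-cont f-cont S (x , x∈S) glb = record
    { isLowerBound = λ (x , x∈S , z≈gfx) →
        isLowerBound gf-glb (f x , (x , x∈S , Q.Eq.refl) , z≈gfx)
    ; isGreatest   = λ lb → isGreatest gf-glb λ (y , (x , x∈S , y≈fx) , z≈gy) →
        R.trans (lb (x , x∈S , R.Eq.refl))
          (R.reflexive (R.Eq.sym
            (R.Eq.trans z≈gy (monotone⇒cong Q R g-mono y≈fx))))
    }
    where
    open IsGreatestLowerBound
    gf-glb : IsGreatestLowerBound R (Image Q R g (Image P Q f S)) (g (f _))
    gf-glb = g-cont (Image P Q f S) (f x , x , x∈S , Q.Eq.refl) (f-cont S (x , x∈S) glb)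

module _ {c ℓ₁ ℓ₂ c′ ℓ₁′ ℓ₂′}
         (L : MeetSemilattice c ℓ₁ ℓ₂) (L′ : MeetSemilattice c′ ℓ₁′ ℓ₂′) where
  private
    module L = MeetSemilattice L
    module L′ = MeetSemilattice L′

  -- A binary meet is the meet of a two-element set.
  continuous⇒distributive : ∀ {f} → Continuous L.poset L′.poset c f → Distributive L L′ f
  continuous⇒distributive {f} f-cont x y = L′.antisym
    (L′.∧-greatest (isLowerBound f-glb (x , inj₁ refl , L′.Eq.refl))
                   (isLowerBound f-glb (y , inj₂ refl , L′.Eq.refl)))
    (isGreatest f-glb λ
      { (_ , inj₁ refl , z≈fx) → L′.trans (L′.x∧y≤x _ _) (L′.reflexive (L′.Eq.sym z≈fx))
      ; (_ , inj₂ refl , z≈fy) → L′.trans (L′.x∧y≤y _ _) (L′.reflexive (L′.Eq.sym z≈fy))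
      })
    where
    open IsGreatestLowerBound
    f-glb : IsGreatestLowerBound L′.poset
              (Image L.poset L′.poset f (｛ x ｝ ∪ ｛ y ｝)) (f (x L.∧ y))
    f-glb = f-cont (｛ x ｝ ∪ ｛ y ｝) (x , inj₁ refl) record
      { isLowerBound = λ { (inj₁ refl) → L.x∧y≤x x y ; (inj₂ refl) → L.x∧y≤y x y }
      ; isGreatest   = λ lb → L.∧-greatest (lb (inj₁ refl)) (lb (inj₂ refl))
      }

module _ {c ℓ₁ ℓ₂ c′ ℓ₁′ ℓ₂′} (P : Poset c ℓ₁ ℓ₂) (L : MeetSemilattice c′ ℓ₁′ ℓ₂′) where
  private
    module P = Poset P
    module L = MeetSemilattice L

  ∧-continuous : ∀ {ℓ f g} → Continuous P L.poset ℓ f → Continuous P L.poset ℓ g →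
                 Continuous P L.poset ℓ (λ x → f x L.∧ g x)
  ∧-continuous f-cont g-cont S ne glb = record
    { isLowerBound = λ (x , x∈S , z≈) → L.trans
        (L.∧-greatest
          (L.trans (L.x∧y≤x _ _) (isLowerBound (f-cont S ne glb) (x , x∈S , L.Eq.refl)))
          (L.trans (L.x∧y≤y _ _) (isLowerBound (g-cont S ne glb) (x , x∈S , L.Eq.refl))))
        (L.reflexive (L.Eq.sym z≈))
    ; isGreatest   = λ lb → L.∧-greatest
        (isGreatest (f-cont S ne glb) λ (x , x∈S , z≈) → L.trans
          (L.trans (lb (x , x∈S , L.Eq.refl)) (L.x∧y≤x _ _)) (L.reflexive (L.Eq.sym z≈)))
        (isGreatest (g-cont S ne glb) λ (x , x∈S , z≈) → L.trans
          (L.trans (lb (x , x∈S , L.Eq.refl)) (L.x∧y≤y _ _)) (L.reflexive (L.Eq.sym z≈)))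
    }
    where open IsGreatestLowerBound

module _ {c ℓ₁ ℓ₂} (L : BoundedMeetSemilattice c ℓ₁ ℓ₂) (n : ℕ) where
  private
    module L = BoundedMeetSemilattice L
    Lⁿ = poset (power L n)

  -- A lower bound x of the i-th coordinates of S yields the lower bound of S
  -- that agrees with ⋀S except for having x at i.
  projection-continuous : ∀ {ℓ} i → Continuous Lⁿ L.poset ℓ (λ xs → xs i)
  projection-continuous i S _ {g} glb = record
    { isLowerBound = λ (xs , xs∈S , y≈) →
        L.trans (isLowerBound glb xs∈S i) (L.reflexive (L.Eq.sym y≈))
    ; isGreatest   = λ {x} lb → subst (L._≤ g i) (updateAt-updates i g)
        (isGreatest glb (λ xs∈S j → updated-≤ x xs∈S (lb (_ , xs∈S , L.Eq.refl)) j) i)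
    }
    where
    open IsGreatestLowerBound
    updated-≤ : ∀ x {xs} → xs ∈ S → x L.≤ xs i → ∀ j → updateAt g i (const x) j L.≤ xs j
    updated-≤ x {xs} xs∈S x≤ j with j Fin.≟ i
    ... | yes refl = subst (L._≤ xs j) (sym (updateAt-updates j g)) x≤
    ... | no j≢i   =
      subst (L._≤ xs j) (sym (updateAt-minimal j i g j≢i)) (isLowerBound glb xs∈S j)

  tuple-continuous : ∀ {c′ ℓ₁′ ℓ₂′ ℓ} (P : Poset c′ ℓ₁′ ℓ₂′)
                     {f : Poset.Carrier P → Vector L.Carrier n} →
                     (∀ i → Continuous P L.poset ℓ (λ x → f x i)) → Continuous P Lⁿ ℓ f
  tuple-continuous P f-cont S ne glb = record
    { isLowerBound = λ (x , x∈S , y≈) i → isLowerBound (f-cont i S ne glb) (x , x∈S , y≈ i)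
    ; isGreatest   = λ lb i → isGreatest (f-cont i S ne glb) λ (x , x∈S , y≈) →
        L.trans (lb (x , x∈S , λ _ → L.Eq.refl) i) (L.reflexive (L.Eq.sym y≈))
    }
    where open IsGreatestLowerBound

-- Kleene's fixed point theorem, for descending iterates.

module _ {c ℓ₁ ℓ₂} (L : BoundedMeetSemilattice c ℓ₁ ℓ₂) where
  private module L = BoundedMeetSemilattice L

  -- By continuity `f s` is the meet of the iterates shifted by one. The shift loses only the
  -- iterate `⊤`, which does not affect a meet, so `f s ≈ s`. By induction every fixed point lies
  -- below every iterate.
  kleene : ∀ {f s} → Monotone L.poset L.poset f → Continuous L.poset L.poset ℓ₁ f →
           IsGreatestLowerBound L.poset (Iterates L.poset f L.⊤) s →
           IsMaximumFixpoint L.poset f s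
  kleene {f} {s} f-mono f-cont glb = L.antisym fs≤s s≤fs , λ s′ fs′≈s′ →
      isGreatest glb λ (m , y≈) →
        L.trans (fixpoint-≤ fs′≈s′ m) (L.reflexive (L.Eq.sym y≈))
    where
    open IsGreatestLowerBound
    f-glb : IsGreatestLowerBound L.poset
              (Image L.poset L.poset f (Iterates L.poset f L.⊤)) (f s)
    f-glb = f-cont _ (L.⊤ , 0 , L.Eq.refl) glb

    fs≤fold : ∀ m → f s L.≤ fold L.⊤ f m
    fs≤fold zero    = L.maximum _
    fs≤fold (suc m) = f-mono (isLowerBound glb (m , L.Eq.refl))

    fs≤s : f s L.≤ s
    fs≤s = isGreatest glb λ (m , y≈) → L.trans (fs≤fold m) (L.reflexive (L.Eq.sym y≈))

    s≤fs : s L.≤ f s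
    s≤fs = isGreatest f-glb λ (x , (m , x≈) , y≈) → isLowerBound glb
      (suc m , L.Eq.trans y≈ (monotone⇒cong L.poset L.poset f-mono x≈))

    fixpoint-≤ : ∀ {s′} → f s′ L.≈ s′ → ∀ m → s′ L.≤ fold L.⊤ f m
    fixpoint-≤ fs′≈s′ zero    = L.maximum _
    fixpoint-≤ fs′≈s′ (suc m) =
      L.trans (L.reflexive (L.Eq.sym fs′≈s′)) (f-mono (fixpoint-≤ fs′≈s′ m))

-- Meets of congruences

module _ {C X : Set} (C-countable : Countable C) (X-countable : Countable X) where
  open Framework C X X-countable
  open AddNonStrict _⪯_ using (_≤⁺_; [_]; _≤⊤⁺; [≤]-injective)
  private
    𝒫 = poset 𝒢̄
    module 𝒫 = Poset 𝒫

  -- Closure under the equivalence laws and both directions of condition (2); the cancellation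
  -- constructors give the converse direction. Conditions (1) and (3) are not closure conditions:
  -- they are inherited from any congruence containing the pair. Unlike an intersection over a large
  -- set, this relation is small.
  data Generated (t t′ : Term) : Rel Term 0ℓ where
    base      : Generated t t′ t t′
    reflex    : ∀ {u} → Generated t t′ u u
    symm      : ∀ {u v} → Generated t t′ u v → Generated t t′ v u
    transit   : ∀ {u v w} → Generated t t′ u v → Generated t t′ v w → Generated t t′ u w
    +-cong    : ∀ {u v u′ v′} → Generated t t′ u′ u → Generated t t′ v′ v →
                Generated t t′ (u′ + v′) (u + v)
    +-cancelˡ : ∀ {u v u′ v′} → Generated t t′ (u′ + v′) (u + v) → Generated t t′ u′ u
    +-cancelʳ : ∀ {u v u′ v′} → Generated t t′ (u′ + v′) (u + v) → Generated t t′ v′ v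

  generated-least : ∀ R {t t′} → R ∋ t ≅ t′ → ∀ {u v} → Generated t t′ u v → R ∋ u ≅ v
  generated-least R p = go
    where
    module R = Congruence R
    go : ∀ {u v} → Generated _ _ u v → R ∋ u ≅ v
    go base          = p
    go reflex        = R.refl
    go (symm q)      = R.sym (go q)
    go (transit q r) = R.trans (go q) (go r)
    go (+-cong q r)  = Equivalence.to R.+-cong-⇔ (go q , go r)
    go (+-cancelˡ q)  = proj₁ (Equivalence.from R.+-cong-⇔ (go q))
    go (+-cancelʳ q) = proj₂ (Equivalence.from R.+-cong-⇔ (go q))

  _≟ᶜ_ : DecidableEquality C
  _≟ᶜ_ = via-injection C-countable ℕ._≟_

  -- con-distinct and con-class are stable under double negation, as equality on C
  -- is decidable; so the witness R need not be known explicitly.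
  generated : ∀ t t′ → ¬ ¬ (∃ λ R → R ∋ t ≅ t′) → Congruence
  generated t t′ ¬¬R = record
    { _≅_           = Generated t t′
    ; isEquivalence = record { refl = reflex ; sym = symm ; trans = transit }
    ; con-distinct  = λ c≢c′ p → ¬¬R λ (R , q) →
        Congruence.con-distinct R c≢c′ (generated-least R q p)
    ; +-cong-⇔      = mk⇔ (λ (p , q) → +-cong p q) (λ p → +-cancelˡ p , +-cancelʳ p)
    ; con-class     = λ {c} {u} → class-of c u
    }
    where
    class-of : ∀ c u → Generated t t′ u (con c) → u ≡ con c ⊎ ∃ λ x → u ≡ var x
    class-of c (var x) p = inj₂ (x , refl)
    class-of c (con d) p with d ≟ᶜ c
    ... | yes refl = inj₁ refl
    ... | no d≢c   = ⊥-elim (¬¬R λ (R , q) →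
      Congruence.con-distinct R d≢c (generated-least R q p))
    class-of c (u + v) p = ⊥-elim (¬¬R λ (R , q) →
      not-con (Congruence.con-class R (generated-least R q p)))
      where
      not-con : ¬ (u + v ≡ con c ⊎ ∃ λ x → u + v ≡ var x)
      not-con (inj₁ ())
      not-con (inj₂ (_ , ()))

  ⊆⇒⪯ : ∀ {P Q} → (∀ {t t′} → P ∋ t ≅ t′ → Q ∋ t ≅ t′) → P ⪯ Q
  ⊆⇒⪯ P⊆Q t = t , P⊆Q

  ⪯⇒≅ : ∀ {P Q} → P ⪯ Q → ∀ {t t′} → P ∋ t ≅ t′ → Q ∋ t ≅ t′
  ⪯⇒≅ {P} {Q} P⪯Q {t′ = t′} = ⪯⇒⊆ {P} {Q} P⪯Q t′

  module _ {ℓ} {S : Pred (Congruence ⁺) ℓ} {P} (glb : IsGreatestLowerBound 𝒫 S [ P ]) where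
    open IsGreatestLowerBound glb

    -- Were `⊤⁺` the only possible member of `S`, it would be a lower bound and hence lie below
    -- `[ P ]`. The argument refutes absence and so exhibits no member.
    glb-inhabited : ¬ ¬ (∃ λ R → [ R ] ∈ S)
    glb-inhabited none with isGreatest {⊤⁺} (λ
      { {⊤⁺} _ → ⊤⁺ ≤⊤⁺ ; {[ R ]} R∈S → ⊥-elim (none (R , R∈S)) })
    ... | ()

    glb-intersection : ∀ {t t′} → (∀ {R} → [ R ] ∈ S → R ∋ t ≅ t′) → P ∋ t ≅ t′
    glb-intersection {t} {t′} all = ⪯⇒≅ {K} {P} ([≤]-injective (isGreatest K-lb)) base
      where
      K : Congruence
      -- A member of `S` identifying the pair is known only up to double negation, which is all that
      -- `generated` asks for.
      K = generated t t′ λ k → glb-inhabited λ (R , R∈S) → k (R , all R∈S)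
      K-lb : ∀ {s} → s ∈ S → [ K ] ≤⁺ s
      K-lb {⊤⁺}    _   = [ K ] ≤⊤⁺
      K-lb {[ R ]} R∈S = [ ⊆⇒⪯ {K} {R} (generated-least R (all R∈S)) ]

  -- Continuity of the transfer functions.

  -- Being identified by `⟦ h ⟧ P` is a conjunction of identifications by `P`, each of which can be
  -- checked in every `R ∈ S`. Assuming only that `P` contains the intersection of `S` covers both
  -- meets and, with a singleton `S`, monotonicity.
  transfer-greatest : ∀ h {ℓ} (S : Pred Congruence ℓ) {P Q} →
    (∀ {t t′} → (∀ {R} → R ∈ S → R ∋ t ≅ t′) → P ∋ t ≅ t′) →
    (∀ {R} → R ∈ S → Q ⪯ ⟦ h ⟧ R) → Q ⪯ ⟦ h ⟧ P
  transfer-greatest h@(y ≔ β ∣ _) S {P} {Q} ⋂S⊆P lb = ⊆⇒⪯ {Q} {⟦ h ⟧ P} λ p →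
    ⋂S⊆P λ {R} R∈S → ⪯⇒≅ {Q} {⟦ h ⟧ R} (lb R∈S) p
  transfer-greatest h@(y ≔*) S {P} {Q} ⋂S⊆P lb = ⊆⇒⪯ {Q} {⟦ h ⟧ P} λ p →
      ⋂S⊆P (λ {R} R∈S → proj₁ (⪯⇒≅ {Q} {⟦ h ⟧ R} (lb R∈S) p))
    , λ β β∉ → ⋂S⊆P λ {R} R∈S → proj₂ (⪯⇒≅ {Q} {⟦ h ⟧ R} (lb R∈S) p) β β∉

  transfer-monotone : ∀ h → Monotone 𝒫 𝒫 ⟦ h ⟧⁺
  transfer-monotone h {P} (_ ≤⊤⁺) = ⟦ h ⟧⁺ P ≤⊤⁺
  transfer-monotone h ([_] {P} {Q} P⪯Q) = [ transfer-greatest h ｛ P ｝ {Q} {⟦ h ⟧ P}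
    (λ all → ⪯⇒≅ {P} {Q} P⪯Q (all refl)) (λ { refl → ⊆⇒⪯ {⟦ h ⟧ P} {⟦ h ⟧ P} (λ p → p) }) ]

  transfer-continuous : ∀ h {ℓ} → Continuous 𝒫 𝒫 ℓ ⟦ h ⟧⁺
  transfer-continuous h S _ {g} glb = record
    { isLowerBound = λ (s , s∈S , y≈) → 𝒫.trans
        (transfer-monotone h (isLowerBound s∈S)) (𝒫.reflexive (𝒫.Eq.sym y≈))
    ; isGreatest   = λ lb → greatest glb λ s∈S → lb (_ , s∈S , 𝒫.Eq.refl)
    }
    where
    open IsGreatestLowerBound glb using (isLowerBound)
    greatest : ∀ {g x} → IsGreatestLowerBound 𝒫 S g →
               (∀ {s} → s ∈ S → x ≤⁺ ⟦ h ⟧⁺ s) → x ≤⁺ ⟦ h ⟧⁺ g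
    greatest {⊤⁺}    {x}     glb lb = x ≤⊤⁺
    -- `S` cannot be without a congruence `R`, and `⊤⁺` is not below `[ ⟦ h ⟧ R ]`; as a
    -- contradiction is sought, double negation is harmless.
    greatest {[ P ]} {⊤⁺}    glb lb = ⊥-elim (glb-inhabited glb λ (R , R∈S) →
      ⊤≰[-] (lb R∈S))
      where
      ⊤≰[-] : ∀ {R} → ¬ (⊤⁺ ≤⁺ [ R ])
      ⊤≰[-] ()
    greatest {[ P ]} {[ Q ]} glb lb =
      [ transfer-greatest h (λ R → [ R ] ∈ S) {P} {Q} (glb-intersection glb)
          (λ R∈S → [≤]-injective (lb R∈S)) ]

  -- Meets of families indexed by a small type.

  -- Reading `⊤⁺` as the total relation makes it neutral for intersection. The total relation is an
  -- equivalence satisfying condition (2), but need not be a congruence.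
  rel : Congruence ⁺ → Rel Term 0ℓ
  rel [ P ] t t′ = P ∋ t ≅ t′
  rel ⊤⁺    t t′ = Unit

  rel-isEquivalence : ∀ x → IsEquivalence (rel x)
  rel-isEquivalence [ P ] = Congruence.isEquivalence P
  rel-isEquivalence ⊤⁺    = record
    { refl = tt ; sym = λ _ → tt ; trans = λ _ _ → tt }

  rel-+-cong-⇔ : ∀ x {t t′ s s′} →
                 (rel x t′ t × rel x s′ s) ⇔ rel x (t′ + s′) (t + s)
  rel-+-cong-⇔ [ P ] = Congruence.+-cong-⇔ P
  rel-+-cong-⇔ ⊤⁺    = mk⇔ (λ _ → tt) (λ _ → tt , tt)

  ≤⁺⇒rel : ∀ {x y} → x ≤⁺ y → ∀ {t t′} → rel x t t′ → rel y t t′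
  ≤⁺⇒rel (_ ≤⊤⁺) _ = tt
  ≤⁺⇒rel ([_] {P} {Q} P⪯Q) = ⪯⇒≅ {P} {Q} P⪯Q

  IsCongruence : Pred (Congruence ⁺) (lsuc 0ℓ)
  IsCongruence x = ∃ λ P → x ≡ [ P ]

  module _ {I : Set} (a : I → Congruence ⁺) (i : I) where

    -- Conditions (1) and (3) pass to subrelations, so one index with a genuine congruence secures
    -- them; the other laws hold at every index separately. As `I` is small, the intersection is
    -- again a relation in `Set`.
    intersection : IsCongruence (a i) → Congruence
    intersection (P , aᵢ≡P) = record
      { _≅_           = λ t t′ → ∀ j → rel (a j) t t′
      ; isEquivalence = record
        { refl  = λ j → IsEquivalence.refl (rel-isEquivalence (a j))
        ; sym   = λ p j → IsEquivalence.sym (rel-isEquivalence (a j)) (p j)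
        ; trans = λ p q j → IsEquivalence.trans (rel-isEquivalence (a j)) (p j) (q j)
        }
      ; con-distinct  = λ c≢c′ p → Congruence.con-distinct P c≢c′ (atᵢ p)
      ; +-cong-⇔      = mk⇔
          (λ (p , q) j → Equivalence.to (rel-+-cong-⇔ (a j)) (p j , q j))
          (λ p → (λ j → proj₁ (Equivalence.from (rel-+-cong-⇔ (a j)) (p j)))
               , (λ j → proj₂ (Equivalence.from (rel-+-cong-⇔ (a j)) (p j))))
      ; con-class     = λ p → Congruence.con-class P (atᵢ p)
      }
      where
      atᵢ : ∀ {t t′} → (∀ j → rel (a j) t t′) → P ∋ t ≅ t′
      atᵢ {t} {t′} p = subst (λ x → rel x t t′) aᵢ≡P (p i)

    intersection-glb : (d : IsCongruence (a i)) →
      IsGreatestLowerBound 𝒫 (λ y → ∃ λ j → y 𝒫.≈ a j) [ intersection d ]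
    intersection-glb d@(P , aᵢ≡P) = record
      { isLowerBound = λ (j , y≈) → 𝒫.trans (lower j) (𝒫.reflexive (𝒫.Eq.sym y≈))
      ; isGreatest   = λ lb → greatest λ j → lb (j , 𝒫.Eq.refl)
      }
      where
      lower : ∀ j → [ intersection d ] ≤⁺ a j
      lower j with a j in eq
      ... | ⊤⁺    = [ intersection d ] ≤⊤⁺
      ... | [ R ] = [ ⊆⇒⪯ {intersection d} {R}
        (λ {t} {t′} p → subst (λ x → rel x t t′) eq (p j)) ]
      greatest : ∀ {x} → (∀ j → x ≤⁺ a j) → x ≤⁺ [ intersection d ]
      greatest {⊤⁺} lb with subst (⊤⁺ ≤⁺_) aᵢ≡P (lb i)
      ... | ()
      greatest {[ Q ]} lb = [ ⊆⇒⪯ {Q} {intersection d} (λ p j → ≤⁺⇒rel (lb j) p) ]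

  ∧⁺-isCongruenceˡ : ∀ {x} y → IsCongruence x → IsCongruence (x ∧⁺ y)
  ∧⁺-isCongruenceˡ ⊤⁺    (P , refl) = P , refl
  ∧⁺-isCongruenceˡ [ Q ] (P , refl) = P ∧ᶜ Q , refl

  ∧⁺-isCongruenceʳ : ∀ x {y} → IsCongruence y → IsCongruence (x ∧⁺ y)
  ∧⁺-isCongruenceʳ ⊤⁺    d          = d
  ∧⁺-isCongruenceʳ [ P ] (Q , refl) = P ∧ᶜ Q , refl

  -- Data flow frameworks

  module _ {m : ℕ} (D : DataFlowFramework m) where
    open DataFlowFramework D
    private
      𝒢̄ⁿ = 𝒢̄^ (suc m)

    component-continuous : ∀ k {ℓ} → Continuous (poset 𝒢̄ⁿ) 𝒫 ℓ (component k)
    component-continuous zero = const-continuous (poset 𝒢̄ⁿ) 𝒫 [ ⊥ᶜ ]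
    component-continuous k@(suc _) with one-or-two k suc≢zero
    ... | inj₁ p@(j , _)   = ∘-continuous (poset 𝒢̄ⁿ) 𝒫 𝒫
      (transfer-monotone (h k p)) (transfer-continuous (h k p))
      (projection-continuous 𝒢̄ (suc m) j)
    ... | inj₂ (i , j , _) = ∧-continuous (poset 𝒢̄ⁿ) (meetSemilattice 𝒢̄)
      (projection-continuous 𝒢̄ (suc m) i) (projection-continuous 𝒢̄ (suc m) j)

    composite-continuous : ∀ {ℓ} → Continuous (poset 𝒢̄ⁿ) (poset 𝒢̄ⁿ) ℓ composite
    composite-continuous =
      tuple-continuous 𝒢̄ (suc m) (poset 𝒢̄ⁿ) λ k → component-continuous k

    composite-monotone : Monotone (poset 𝒢̄ⁿ) (poset 𝒢̄ⁿ) composite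
    composite-monotone =
      continuous⇒monotone (poset 𝒢̄ⁿ) (poset 𝒢̄ⁿ) composite-continuous

    -- The iterates of the composite transfer function and their meet.

    iterate : ℕ → Vector (Congruence ⁺) (suc m)
    iterate = fold (⊤ 𝒢̄ⁿ) composite

    -- One predecessor below `⊤⁺` suffices, even at a confluence point: a meet with a congruence is
    -- a congruence.
    component-isCongruence : ∀ {i k} → i ⟶ k → ∀ Ps →
      IsCongruence (Ps i) → IsCongruence (component k Ps)
    component-isCongruence {k = zero} _ _ _ = ⊥ᶜ , refl
    component-isCongruence {k = k@(suc _)} i⟶k Ps d with one-or-two k suc≢zero
    ... | inj₁ p@(j , pred≐) with refl ← proj₁ pred≐ i⟶k | P , Psᵢ≡P ← d
      rewrite Psᵢ≡P = ⟦ h k p ⟧ P , refl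
    ... | inj₂ (i , j , _ , pred≐) with proj₁ pred≐ i⟶k
    ...   | inj₁ refl = ∧⁺-isCongruenceˡ (Ps j) d
    ...   | inj₂ refl = ∧⁺-isCongruenceʳ (Ps i) d

    -- Each edge of the path costs one further iteration.
    path-isCongruence : ∀ {i k} → Star _⟶_ i k → (∃ λ r → IsCongruence (iterate r i)) →
                        ∃ λ r → IsCongruence (iterate r k)
    path-isCongruence ε          d       = d
    path-isCongruence (e ◅ path) (r , d) =
      path-isCongruence path (suc r , component-isCongruence e (iterate r) d)

    eventually-isCongruence : ∀ k → ∃ λ r → IsCongruence (iterate r k)
    -- Iterate `0` is `⊤⁺` everywhere; the first application of `composite` puts `⊥ᶜ` at the entry
    -- point.
    eventually-isCongruence zero      = 1 , ⊥ᶜ , refl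
    eventually-isCongruence k@(suc _) =
      path-isCongruence (reachable k suc≢zero) (1 , ⊥ᶜ , refl)

    -- The stage `r` depends on `k` and certifies that the intersection over all iterates at `k` is
    -- a congruence.
    limit : Vector (Congruence ⁺) (suc m)
    limit k = let r , d = eventually-isCongruence k in
      [ intersection (λ q → iterate q k) r d ]

    limit-glb : IsGreatestLowerBound (poset 𝒢̄ⁿ)
                  (Iterates (poset 𝒢̄ⁿ) composite (⊤ 𝒢̄ⁿ)) limit
    limit-glb = record
      { isLowerBound = λ (q , y≈) k → isLowerBound (coordinate k) (q , y≈ k)
      -- Meets in the power are coordinatewise: a value at `k` comes from a whole iterate, to which
      -- `lb` applies.
      ; isGreatest   = λ lb k → isGreatest (coordinate k) λ (q , y≈) → 𝒫.trans
          (lb (q , λ _ → 𝒫.Eq.refl) k) (𝒫.reflexive (𝒫.Eq.sym y≈))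
      }
      where
      open IsGreatestLowerBound
      coordinate : ∀ k → IsGreatestLowerBound 𝒫 (λ y → ∃ λ q → y 𝒫.≈ iterate q k) (limit k)
      coordinate k = let r , d = eventually-isCongruence k in
        intersection-glb (λ q → iterate q k) r d

    limit-isMaximumFixpoint : IsMaximumFixpoint (poset 𝒢̄ⁿ) composite limit
    limit-isMaximumFixpoint = kleene 𝒢̄ⁿ composite-monotone composite-continuous limit-glb

theorem9p8 : (ℓ : Level) (C X : Set) → Countable C → (X-countable : Countable X) →
    let open Framework C X X-countable in
    (m : ℕ) (D : DataFlowFramework m) →
    let open DataFlowFramework D in
    let 𝒢̄ⁿ = 𝒢̄^ (suc m) in
    (Monotone (poset 𝒢̄ⁿ) (poset 𝒢̄ⁿ) composite
    × Distributive (meetSemilattice 𝒢̄ⁿ) (meetSemilattice 𝒢̄ⁿ) composite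
    × Continuous (poset 𝒢̄ⁿ) (poset 𝒢̄ⁿ) ℓ composite)
    × ((k : Fin (suc m)) → Continuous (poset 𝒢̄ⁿ) (poset 𝒢̄) ℓ (component k))
    × (∃ λ s → IsMaximumFixpoint (poset 𝒢̄ⁿ) composite s)
    × (∃ λ s → IsGreatestLowerBound (poset 𝒢̄ⁿ) (Iterates (poset 𝒢̄ⁿ) composite (⊤ 𝒢̄ⁿ)) s
    × IsMaximumFixpoint (poset 𝒢̄ⁿ) composite s)
theorem9p8 ℓ C X C-countable X-countable m D =
    ( composite-monotone C-countable X-countable D
    , continuous⇒distributive (meetSemilattice 𝒢̄ⁿ) (meetSemilattice 𝒢̄ⁿ)
        (composite-continuous C-countable X-countable D)
    , composite-continuous C-countable X-countable D)
  , (λ k → component-continuous C-countable X-countable D k)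
  , (limit C-countable X-countable D , max)
  , (limit C-countable X-countable D , limit-glb C-countable X-countable D , max)
  where
  open Framework C X X-countable
  𝒢̄ⁿ = 𝒢̄^ (suc m)
  max = limit-isMaximumFixpoint C-countable X-countable D
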